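{- For every positive integer $k$, there is an infinite family of (pairwise non-isomorphic) $k$-connected graphs $G$ for which $\chi_T(G)\ne\chi_P(G)$.
   Context: Graphs are finite and simple. A tree-decomposition of a graph $G$ is a pair $(T,\mathcal{B})$ where $T$ is a tree and $\mathcal{B}=\{B_t: t\in V(T)\}$ is a collection of subsets of $V(G)$ (bags) such that $V(G)=\bigcup_{t\in V(T)}B_t$; for each $uv\in E(G)$ there is $t\in V(T)$ with $u,v\in B_t$; and for each $v\in V(G)$ the set of all $t\in V(T)$ with $v\in B_t$ induces a connected subtree of $T$. If $T$ is a path, it is called a path-decomposition. The chromatic number of $(T,\mathcal{B})$ is $\max\{\chi(G[B_t]): t\in V(T)\}$. The tree-chromatic number $\chi_T(G)$ is the minimum chromatic number over all tree-decompositions of $G$; the path-chromatic number $\chi_P(G)$ is the minimum chromatic number over all path-decompositions of $G$. -}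

module Defs where

open import Data.Bool using (true; false)
open import Data.Fin using (Fin; zero; suc; toℕ; inject₁; fromℕ)
open import Data.Fin.Permutation using (Permutation; _⟨$⟩ʳ_)
open import Data.Fin.Subset using (Subset; _∈_; ∁; ∣_∣)
open import Data.Nat using (ℕ; suc; _≤_; _<_; _≟_)
open import Data.Nat.Properties using (1+n≢n)
open import Data.Product using (Σ; ∃-syntax; _×_)
open import Data.Sum using (_⊎_; [_,_]; swap)
open import Data.Vec using (_∷_; tabulate; lookup)
open import Function.Bundles using (_⇔_)
open import Function.Definitions using (Injective)
open import Level using (Level; 0ℓ)
open import Relation.Binary.Construct.Closure.ReflexiveTransitive using (Star)
open import Relation.Binary.Core using (Rel)
open import Relation.Binary.Definitions using (Decidable; Symmetric)
open import Relation.Binary.PropositionalEquality using (_≡_; _≢_)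
open import Relation.Nullary using (¬_)
open import Relation.Nullary.Decidable using (_⊎-dec_)

IsLeast : {ℓ : Level} → (ℕ → Set ℓ) → ℕ → Set ℓ
IsLeast P k = P k × (∀ j → P j → k ≤ j)

IsGreatest : {ℓ : Level} → (ℕ → Set ℓ) → ℕ → Set ℓ
IsGreatest P k = P k × (∀ j → P j → j ≤ k)

record Graph : Set₁ where
  field
    order  : ℕ
    Adj    : Rel (Fin order) 0ℓ
    Adj?   : Decidable Adj
    sym    : Symmetric Adj
    irrefl : ∀ v → ¬ Adj v v

  Vertex : Set
  Vertex = Fin order

open Graph public using (order; Adj; Vertex)

infix 4 _≅_

record _≅_ (G H : Graph) : Set where
  field
    bijection : Permutation (order G) (order H)
    preserves : ∀ u v → Adj G u v ⇔ Adj H (bijection ⟨$⟩ʳ u) (bijection ⟨$⟩ʳ v)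

-- The increasing enumeration of the elements of S.
nth : {n : ℕ} (S : Subset n) → Fin ∣ S ∣ → Fin n
nth (true  ∷ S) zero    = zero
nth (true  ∷ S) (suc i) = suc (nth S i)
nth (false ∷ S) i       = suc (nth S i)

-- The induced subgraph G[S], with its vertices relabelled along nth so that
-- it is again a graph on some Fin n.
infix 9 _[_]

_[_] : (G : Graph) → Subset (order G) → Graph
G [ S ] = record
  { order  = ∣ S ∣
  ; Adj    = λ i j → Adj G (nth S i) (nth S j)
  ; Adj?   = λ i j → Graph.Adj? G (nth S i) (nth S j)
  ; sym    = Graph.sym G
  ; irrefl = λ i → Graph.irrefl G (nth S i)
  }

-- The null graph is not connected.
Connected : Graph → Set
Connected G = Vertex G × (∀ u v → Star (Adj G) u v)

-- G − X is the subgraph induced by the complement of X.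
KConnected : ℕ → Graph → Set
KConnected k G = k < order G × (∀ (X : Subset (order G)) → ∣ X ∣ < k → Connected (G [ ∁ X ]))

-- A cycle has length 3 + ℓ, with consecutive vertices c 0, …, c (2 + ℓ).
record Cycle (G : Graph) : Set where
  field
    ℓ         : ℕ
    c         : Fin (suc (suc (suc ℓ))) → Vertex G
    injective : Injective _≡_ _≡_ c
    steps     : ∀ i → Adj G (c (inject₁ i)) (c (suc i))
    closes    : Adj G (c (fromℕ (suc (suc ℓ)))) (c zero)

IsTree : Graph → Set
IsTree T = Connected T × ¬ Cycle T

pathGraph : ℕ → Graph
pathGraph n = record
  { order  = n
  ; Adj    = λ i j → suc (toℕ i) ≡ toℕ j ⊎ suc (toℕ j) ≡ toℕ i
  ; Adj?   = λ i j → (suc (toℕ i) ≟ toℕ j) ⊎-dec (suc (toℕ j) ≟ toℕ i)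
  ; sym    = swap
  ; irrefl = λ _ → [ 1+n≢n , 1+n≢n ]
  }

IsPath : Graph → Set
IsPath T = ∃[ n ] (T ≅ pathGraph n)

Colourable : Graph → ℕ → Set
Colourable G k = Σ (Vertex G → Fin k) λ f → ∀ {u v} → Adj G u v → f u ≢ f v

-- χ(G) = k
ChromaticNumber : Graph → ℕ → Set
ChromaticNumber G = IsLeast (Colourable G)

record TreeDecomposition (G : Graph) : Set₁ where
  field
    tree   : Graph
    isTree : IsTree tree
    bag    : Vertex tree → Subset (order G)

  -- { t | v ∈ bag t }
  nodesOf : Vertex G → Subset (order tree)
  nodesOf v = tabulate λ t → lookup (bag t) v

  field
    coversVertices : ∀ v → ∃[ t ] (v ∈ bag t)
    coversEdges    : ∀ {u v} → Adj G u v → ∃[ t ] (u ∈ bag t × v ∈ bag t)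
    subtree        : ∀ v → Connected (tree [ nodesOf v ])

open TreeDecomposition public using (tree; bag)

record PathDecomposition (G : Graph) : Set₁ where
  field
    treeDecomposition : TreeDecomposition G
    isPath            : IsPath (tree treeDecomposition)

open PathDecomposition public using (treeDecomposition)

-- max { χ(G[bag t]) | t a node of the tree } = k
DecompositionChromaticNumber : {G : Graph} → TreeDecomposition G → ℕ → Set
DecompositionChromaticNumber {G} D =
  IsGreatest λ c → ∃[ t ] ChromaticNumber (G [ bag D t ]) c

-- χ_T(G) = k
TreeChromaticNumber : Graph → ℕ → Set₁
TreeChromaticNumber G =
  IsLeast λ c → Σ (TreeDecomposition G) λ D → DecompositionChromaticNumber D c

-- χ_P(G) = k
PathChromaticNumber : Graph → ℕ → Set₁
PathChromaticNumber G =
  IsLeast λ c → Σ (PathDecomposition G) λ D →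
    DecompositionChromaticNumber (treeDecomposition D) c

{-# OPTIONS --safe #-}
module Submission where

-- Let G consist of three disjoint 5-cycles ("legs") and a hub for every triple
-- z of positions in the 5-cycle, the hubs being independent and z joined on leg i
-- to the two cycle neighbours of z i.
--
-- χ_T(G) = 2: the star with all hubs and vertices 0, 2 of every leg in the centre
-- needs two leaves per leg, carrying {0,1,2} with all hubs, respectively
-- {0,2,3,4} with the hubs that miss position 1 on this leg. There each hub can be
-- coloured like the position it occupies on the leg.
--
-- χ_P(G) = 3: putting each leg with all hubs in one bag gives 3 colours. Conversely,
-- view a path-decomposition as intervals [l v , r v]. If a leg is not contained in
-- a bag, let v₀ be its first vertex to end and v₂ its last to start; they are not
-- adjacent, so the leg is v₀v₁v₂v₃v₄ up to reflection, and v₁, v₃, v₄ share a bag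
-- at some q with r v₀ ≤ q ≤ l v₂. Consider the leg whose q is the middle one of the
-- three. A hub joined to v₀ on the left leg and to v₂ on the right leg is forced
-- into bag q, and two of them imitate v₀ and v₂ on the middle leg, completing a
-- 5-cycle inside this bag.
--
-- Replacing every vertex by m > k independent copies preserves both numbers and makes
-- the graph k-connected, because fewer than m deletions spare a copy of each vertex.

open import Data.Bool using (true; false)
open import Data.Empty using (⊥)
open import Data.Fin as Fin using (Fin; zero; suc; toℕ; inject₁; inject≤; fromℕ; remQuot; combine; finToFun; funToFin)
open import Data.Fin.Patterns using (0F; 1F; 2F; 3F; 4F)
open import Data.Fin.Permutation using (_⟨$⟩ʳ_; _⟨$⟩ˡ_; ↔⇒≡; inverseˡ)
import Data.Fin.Properties as Fin
open import Data.Fin.Relation.Unary.Top using (view; ‵fromℕ; ‵inject₁)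
open import Data.Fin.Subset using (Subset; _∈_; _∉_; _⊆_; _∪_; ⁅_⁆; ∁; ∣_∣) renaming (⊤ to full)
open import Data.Fin.Subset.Properties using (_∈?_; ∈⊤; ⊆-refl; ⊆⊤; x∉p⇒x∈∁p)
open import Data.List using (allFin)
import Data.List.Extrema as Extrema
open import Data.List.Membership.Propositional.Properties using (∈-allFin)
import Data.List.Relation.Unary.All as All
open import Data.Nat using (ℕ; suc; _+_; _*_; _^_; _≤_; _<_; _≥_; z≤n; s≤s; NonZero)
open import Data.Nat.Induction using (<-rec)
import Data.Nat.Properties as ℕ
open import Data.Product using (Σ; ∃; ∃₂; ∃-syntax; _×_; _,_; proj₁; proj₂)
open import Data.Sum using (_⊎_; inj₁; inj₂; swap)
open import Data.Sum.Function.Propositional using (_⊎-↔_)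
open import Data.Unit using (⊤; tt)
open import Data.Vec using ([]; _∷_; here; there; lookup; tabulate)
open import Data.Vec.Functional using (updateAt)
open import Data.Vec.Functional.Properties using (updateAt-updates; updateAt-minimal)
open import Data.Vec.Properties using (lookup∘tabulate; []=⇒lookup; lookup⇒[]=)
open import Function using (_∘_; id; const; _↔_; Inverse; Equivalence)
open import Function.Construct.Composition using (_↔-∘_)
open import Function.Construct.Identity using (↔-id; ⇔-id)
open import Function.Definitions using (Injective)
open import Level using (0ℓ)
open import Relation.Binary.Construct.Closure.ReflexiveTransitive using (Star; ε; _◅_; _◅◅_; reverse)
open import Relation.Binary.Core using (Rel)
open import Relation.Binary.Definitions using (Decidable; Symmetric)
open import Relation.Binary.PropositionalEquality using (_≡_; _≢_; refl; sym; trans; cong; subst; subst₂; ≢-sym)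
open import Relation.Nullary using (¬_; Dec; yes; no; does; contradiction)
open import Relation.Nullary.Decidable using (dec-true; decidable-stable; from-yes; ¬?; _×-dec_; _⊎-dec_; _→-dec_)
open import Defs

-- Subsets, their enumerations, and extrema

nth-∈ : ∀ {n} (S : Subset n) i → nth S i ∈ S
nth-∈ (true  ∷ S) zero    = here
nth-∈ (true  ∷ S) (suc i) = there (nth-∈ S i)
nth-∈ (false ∷ S) i       = there (nth-∈ S i)

nth-injective : ∀ {n} (S : Subset n) → Injective _≡_ _≡_ (nth S)
nth-injective (true  ∷ S) {zero}  {zero}  _  = refl
nth-injective (true  ∷ S) {suc i} {suc j} eq = cong suc (nth-injective S (Fin.suc-injective eq))
nth-injective (false ∷ S)                 eq = nth-injective S (Fin.suc-injective eq)

index : ∀ {n} {S : Subset n} {x} → x ∈ S → Fin ∣ S ∣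
index {S = true  ∷ S} here        = zero
index {S = true  ∷ S} (there x∈S) = suc (index x∈S)
index {S = false ∷ S} (there x∈S) = index x∈S

nth-index : ∀ {n} {S : Subset n} {x} (x∈S : x ∈ S) → nth S (index x∈S) ≡ x
nth-index {S = true  ∷ S} here        = refl
nth-index {S = true  ∷ S} (there x∈S) = cong suc (nth-index x∈S)
nth-index {S = false ∷ S} (there x∈S) = cong suc (nth-index x∈S)

module _ {n : ℕ} {P : Fin n → Set} (P? : ∀ x → Dec (P x)) where

  ⟪_⟫ : Subset n
  ⟪_⟫ = tabulate (does ∘ P?)

  ∈-⟪⟫⁺ : ∀ {x} → P x → x ∈ ⟪_⟫
  ∈-⟪⟫⁺ {x} px = lookup⇒[]= x ⟪_⟫ (trans (lookup∘tabulate _ x) (dec-true (P? x) px))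

  ∈-⟪⟫⁻ : ∀ {x} → x ∈ ⟪_⟫ → P x
  ∈-⟪⟫⁻ {x} x∈ with P? x | trans (sym (lookup∘tabulate (does ∘ P?) x)) ([]=⇒lookup x∈)
  ... | yes px | _ = px

module _ {m n : ℕ} (B : Fin m → Subset n) {v : Fin n} {t : Fin m} where

  ∈-transpose⁺ : v ∈ B t → t ∈ tabulate (λ t → lookup (B t) v)
  ∈-transpose⁺ v∈ = lookup⇒[]= _ _ (trans (lookup∘tabulate (λ t → lookup (B t) v) t) ([]=⇒lookup v∈))

  ∈-transpose⁻ : t ∈ tabulate (λ t → lookup (B t) v) → v ∈ B t
  ∈-transpose⁻ t∈ = lookup⇒[]= _ _ (trans (sym (lookup∘tabulate (λ t → lookup (B t) v) t)) ([]=⇒lookup t∈))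

abstract
  ∃-min : ∀ {m} → Fin m → (f : Fin m → ℕ) → ∃ λ i → ∀ j → f i ≤ f j
  ∃-min {m} i₀ f = argmin f i₀ (allFin m) , λ j →
    All.lookup (f[argmin]≤f[xs] i₀ (allFin m)) (∈-allFin j)
    where open Extrema ℕ.≤-totalOrder

  ∃-max : ∀ {m} → Fin m → (f : Fin m → ℕ) → ∃ λ i → ∀ j → f j ≤ f i
  ∃-max {m} i₀ f = argmax f i₀ (allFin m) , λ j →
    All.lookup (f[xs]≤f[argmax] i₀ (allFin m)) (∈-allFin j)
    where open Extrema ℕ.≤-totalOrder

-- For an undecided `P` the least element is reached only up to double negation: if there is none,
-- strong induction refutes every `P n`.
¬¬-least : {P : ℕ → Set} → ∀ n → P n → ¬ ¬ ∃ (IsLeast P)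
¬¬-least {P} n pn none = <-rec (λ n → ¬ P n) step n pn
  where
  step : ∀ n → (∀ {j} → j < n → ¬ P j) → ¬ P n
  step n ¬P<n pn = none (n , pn , λ j pj → ℕ.≮⇒≥ λ j<n → ¬P<n j<n pj)

-- Chromatic numbers of decompositions

Colourable-mono : ∀ G {c d} → c ≤ d → Colourable G c → Colourable G d
Colourable-mono G c≤d (f , proper) =
  (λ v → inject≤ (f v) c≤d) , λ uv eq → proper uv (Fin.inject≤-injective c≤d c≤d _ _ eq)

Colourable-order : ∀ G → Colourable G (order G)
Colourable-order G = id , λ { uv refl → Graph.irrefl G _ uv }

module _ {G : Graph} {d : ℕ} where

  exact-chromatic-number : (D : TreeDecomposition G) →
    (∀ t → Colourable (G [ bag D t ]) (suc d)) →
    (∃[ t ] ¬ Colourable (G [ bag D t ]) d) →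
    DecompositionChromaticNumber D (suc d)
  exact-chromatic-number D col (t , ¬col) =
    (t , col t , λ j colⱼ → ℕ.≰⇒> λ j≤d → ¬col (Colourable-mono (G [ bag D t ]) j≤d colⱼ)) ,
    λ { _ (s , _ , least) → least (suc d) (col s) }

  -- Whether a bag is d-colourable need not be decided: the claim is a
  -- stable inequality, so the chromatic number of the bag is only needed
  -- up to double negation.
  uncolourable⇒< : ∀ (D : TreeDecomposition G) {c} →
    (∃[ t ] ¬ Colourable (G [ bag D t ]) d) →
    DecompositionChromaticNumber D c → d < c
  uncolourable⇒< D (t , ¬col) (_ , greatest) = ℕ.≰⇒> λ c≤d →
    ¬¬-least _ (Colourable-order (G [ bag D t ])) λ { (χ , col , least) →
      ¬col (Colourable-mono (G [ bag D t ]) (ℕ.≤-trans (greatest χ (t , col , least)) c≤d) col) }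

edge⇒¬1-colourable : ∀ {G u v} → Adj G u v → ¬ Colourable G 1
edge⇒¬1-colourable {u = u} {v} uv (f , proper) with f u | f v | proper uv
... | 0F | 0F | 0≢0 = 0≢0 refl

next : Fin 5 → Fin 5
next 0F = 1F
next 1F = 2F
next 2F = 3F
next 3F = 4F
next 4F = 0F

-- A closed walk of length five rather than a cycle: odd closed walks already rule out two colours.
record Pentagon {V : Set} (_~_ : Rel V 0ℓ) (P : V → Set) : Set where
  field
    corner : Fin 5 → V
    side   : ∀ i → corner i ~ corner (next i)
    inside : ∀ i → P (corner i)

pentagon⇒¬2-colourable : ∀ {G S} → Pentagon (Adj G) (_∈ S) → ¬ Colourable (G [ S ]) 2
pentagon⇒¬2-colourable {G} {S} pentagon (f , proper) =
  -- With two colours, corners two steps apart agree, so corners 0, 2 and 4 agree, although 4 and 0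
  -- are joined.
  g-proper 4F (sym (trans (two-steps (g-proper 0F) (g-proper 1F)) (two-steps (g-proper 2F) (g-proper 3F))))
  where
  open Pentagon pentagon
  g : Fin 5 → Fin 2
  g i = f (index (inside i))
  g-proper : ∀ i → g i ≢ g (next i)
  g-proper i = proper (subst₂ (Adj G) (sym (nth-index (inside i))) (sym (nth-index (inside (next i)))) (side i))
  two-steps : {x y z : Fin 2} → x ≢ y → y ≢ z → x ≡ z
  two-steps {0F} {0F}      p _ = contradiction refl p
  two-steps {0F} {1F} {0F} _ _ = refl
  two-steps {0F} {1F} {1F} _ q = contradiction refl q
  two-steps {1F} {1F}      p _ = contradiction refl p
  two-steps {1F} {0F} {1F} _ _ = refl
  two-steps {1F} {0F} {0F} _ q = contradiction refl q

-- Trees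

-- Strong induction on the rank yields a walk from each vertex to the root; one such walk followed
-- by the reverse of another joins any two vertices.
connected-by-descent : ∀ G (rank : Vertex G → ℕ) (root : Vertex G) →
  (∀ v → v ≢ root → ∃[ w ] (rank w < rank v × Adj G v w)) → Connected G
connected-by-descent G rank root descend =
  root , λ u v → to-root u ◅◅ reverse (Graph.sym G) (to-root v)
  where
  walk : ∀ n v → rank v ≡ n → Star (Adj G) v root
  walk = <-rec _ λ n rec v eq → step n rec v eq
    where
    step : ∀ n → (∀ {m} → m < n → ∀ v → rank v ≡ m → Star (Adj G) v root) →
           ∀ v → rank v ≡ n → Star (Adj G) v root
    step n rec v refl with v Fin.≟ root
    ... | yes refl = ε
    ... | no v≢root with w , w<v , vw ← descend v v≢root = vw ◅ rec w<v w refl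
  to-root : ∀ v → Star (Adj G) v root
  to-root v = walk _ v refl

induced-connected-by-descent : ∀ G (S : Subset (order G)) {root} → root ∈ S →
  (∀ {v} → v ∈ S → v ≢ root → ∃[ w ] (toℕ w < toℕ v × Adj G v w × w ∈ S)) →
  Connected (G [ S ])
induced-connected-by-descent G S root∈S descend =
  connected-by-descent (G [ S ]) (toℕ ∘ nth S) (index root∈S) λ i i≢root →
    let w , w<v , vw , w∈S = descend (nth-∈ S i) λ eq →
          i≢root (nth-injective S (trans eq (sym (nth-index root∈S))))
        eq = sym (nth-index w∈S)
    in index w∈S , subst (λ x → toℕ x < toℕ (nth S i)) eq w<v , subst (Adj G (nth S i)) eq vw

module _ {G : Graph} (cyc : Cycle G) where
  open Cycle cyc

  successor : ∀ i → ∃ λ k → Adj G (c i) (c k) ×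
    (toℕ k ≡ suc (toℕ i) ⊎ toℕ k ≡ 0 × toℕ i ≡ suc (suc ℓ))
  successor i with view i
  ... | ‵fromℕ     = zero , closes , inj₂ (refl , Fin.toℕ-fromℕ _)
  ... | ‵inject₁ k = suc k , steps k , inj₁ (cong suc (sym (Fin.toℕ-inject₁ k)))

  cycle-neighbours : ∀ i → ∃₂ λ j k → j ≢ k × Adj G (c i) (c j) × Adj G (c i) (c k)
  cycle-neighbours zero    = suc zero , fromℕ _ , (λ ()) , steps zero , Graph.sym G closes
  cycle-neighbours (suc j) with k , i~k , position ← successor (suc j) =
    inject₁ j , k , distinct position , Graph.sym G (steps j) , i~k
    where
    distinct : ∀ {k} → toℕ k ≡ suc (suc (toℕ j)) ⊎ toℕ k ≡ 0 × suc (toℕ j) ≡ suc (suc ℓ) → inject₁ j ≢ k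
    distinct (inj₁ eq)         refl = ℕ.<⇒≢ (ℕ.m<n+m _ {2} (s≤s z≤n)) (trans (sym (Fin.toℕ-inject₁ j)) eq)
    -- At the wrap-around the last index would have to be 1, but it is at least 2.
    distinct (inj₂ (eq , eq′)) refl with () ← trans (sym (cong suc (trans (sym (Fin.toℕ-inject₁ j)) eq))) eq′

-- At the highest-numbered vertex of a cycle both cycle neighbours are lower, hence equal,
-- contradicting their distinctness.
acyclic : ∀ G →
  (∀ {u v w} → Adj G u v → Adj G u w → toℕ v < toℕ u → toℕ w < toℕ u → v ≡ w) → ¬ Cycle G
acyclic G unique-lower cyc
  with i , top ← ∃-max zero (toℕ ∘ Cycle.c cyc)
  with j , k , j≢k , ij , ik ← cycle-neighbours cyc i =
  j≢k (injective (unique-lower ij ik (lower ij) (lower ik)))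
  where
  open Cycle cyc
  lower : ∀ {j} → Adj G (c i) (c j) → toℕ (c j) < toℕ (c i)
  lower ij = ℕ.≤∧≢⇒< (top _) λ eq → Graph.irrefl G _ (subst (Adj G (c i)) (Fin.toℕ-injective eq) ij)

pathGraph-isTree : ∀ n → IsTree (pathGraph (suc n))
pathGraph-isTree n = connected-by-descent (pathGraph (suc n)) toℕ zero descend , acyclic _ unique
  where
  descend : ∀ v → v ≢ zero → ∃[ w ] (toℕ w < toℕ v × Adj (pathGraph (suc n)) v w)
  descend zero    0≢0 = contradiction refl 0≢0
  descend (suc v) _   = inject₁ v , s≤s (ℕ.≤-reflexive (Fin.toℕ-inject₁ v)) , inj₂ (cong suc (Fin.toℕ-inject₁ v))
  unique : ∀ {u v w} → Adj (pathGraph (suc n)) u v → Adj (pathGraph (suc n)) u w →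
           toℕ v < toℕ u → toℕ w < toℕ u → v ≡ w
  unique (inj₁ uv) _ v<u _ = contradiction v<u (ℕ.<-asym (ℕ.≤-reflexive uv))
  unique _ (inj₁ uw) _ w<u = contradiction w<u (ℕ.<-asym (ℕ.≤-reflexive uw))
  unique (inj₂ uv) (inj₂ uw) _ _ = Fin.toℕ-injective (ℕ.suc-injective (trans uv (sym uw)))

star : ℕ → Graph
star n = record
  { order  = suc n
  ; Adj    = StarAdj
  ; Adj?   = StarAdj?
  ; sym    = λ {u} {v} → StarAdj-sym {u} {v}
  ; irrefl = λ { zero () ; (suc _) () }
  }
  where
  StarAdj : Rel (Fin (suc n)) 0ℓ
  StarAdj zero    (suc _) = ⊤
  StarAdj (suc _) zero    = ⊤
  StarAdj _       _       = ⊥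
  StarAdj? : Decidable StarAdj
  StarAdj? zero    zero    = no id
  StarAdj? zero    (suc _) = yes tt
  StarAdj? (suc _) zero    = yes tt
  StarAdj? (suc _) (suc _) = no id
  StarAdj-sym : Symmetric StarAdj
  StarAdj-sym {zero}  {suc _} _ = tt
  StarAdj-sym {suc _} {zero}  _ = tt

star-isTree : ∀ n → IsTree (star n)
star-isTree n = connected-by-descent (star n) toℕ zero descend , acyclic (star n) λ {u} {v} {w} → unique {u} {v} {w}
  where
  descend : ∀ v → v ≢ zero → ∃[ w ] (toℕ w < toℕ v × Adj (star n) v w)
  descend zero    0≢0 = contradiction refl 0≢0
  descend (suc v) _   = zero , s≤s z≤n , tt
  unique : ∀ {u v w} → Adj (star n) u v → Adj (star n) u w → toℕ v < toℕ u → toℕ w < toℕ u → v ≡ w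
  unique {suc _} {zero} {zero} _ _ _ _ = refl

-- Path-decompositions as families of intervals

-- Adjacent vertices have intersecting intervals: `meet` is one of the two inequalities, and
-- symmetry of adjacency gives the other.
record IntervalModel {G : Graph} (D : TreeDecomposition G) : Set where
  field
    length : ℕ
    l r    : Vertex G → Fin length
    node   : Fin length → Vertex (tree D)
    l≤r    : ∀ v → l v Fin.≤ r v
    meet   : ∀ {u v} → Adj G u v → l u Fin.≤ r v
    convex : ∀ {v p} → l v Fin.≤ p → p Fin.≤ r v → v ∈ bag D (node p)

intervalModel : ∀ {G} (D : PathDecomposition G) → IntervalModel (treeDecomposition D)
intervalModel {G} D with n , iso ← PathDecomposition.isPath D = record
  { length = n
  ; l      = λ v → pos (nth (S v) (proj₁ (low v)))
  ; r      = λ v → pos (nth (S v) (proj₁ (high v)))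
  ; node   = bijection ⟨$⟩ˡ_
  ; l≤r    = λ v → proj₂ (low v) (proj₁ (high v))
  ; meet   = meet
  ; convex = convex
  }
  where
  open _≅_ iso
  open TreeDecomposition (treeDecomposition D) using (coversEdges; subtree) renaming (tree to T; nodesOf to S; bag to B)

  pos : Vertex T → Fin n
  pos = bijection ⟨$⟩ʳ_

  low  = λ v → ∃-min (proj₁ (subtree v)) (toℕ ∘ pos ∘ nth (S v))
  high = λ v → ∃-max (proj₁ (subtree v)) (toℕ ∘ pos ∘ nth (S v))

  l≤ : ∀ {v t} → v ∈ B t → pos (nth (S v) (proj₁ (low v))) Fin.≤ pos t
  l≤ {v} v∈ = subst (λ t → pos (nth (S v) (proj₁ (low v))) Fin.≤ pos t)
    (nth-index (∈-transpose⁺ B v∈)) (proj₂ (low v) _)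

  ≤r : ∀ {v t} → v ∈ B t → pos t Fin.≤ pos (nth (S v) (proj₁ (high v)))
  ≤r {v} v∈ = subst (λ t → pos t Fin.≤ pos (nth (S v) (proj₁ (high v))))
    (nth-index (∈-transpose⁺ B v∈)) (proj₂ (high v) _)

  meet : ∀ {u v} → Adj G u v → pos (nth (S u) (proj₁ (low u))) Fin.≤ pos (nth (S v) (proj₁ (high v)))
  meet uv with t , u∈ , v∈ ← coversEdges uv = ℕ.≤-trans (l≤ u∈) (≤r v∈)

  pos-step : ∀ {s t} → Adj T s t → toℕ (pos t) ≤ suc (toℕ (pos s))
  pos-step {s} {t} st with Equivalence.to (preserves s t) st
  ... | inj₁ eq = ℕ.≤-reflexive (sym eq)
  ... | inj₂ eq = ℕ.≤-trans (ℕ.n≤1+n _) (ℕ.≤-trans (ℕ.≤-reflexive eq) (ℕ.n≤1+n _))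

  -- A discrete intermediate value theorem: by `pos-step` a walk climbs at most one position at a
  -- time, so it cannot jump over `p`.
  intermediate : ∀ {v i j p} → Star (Adj (T [ S v ])) i j →
    pos (nth (S v) i) Fin.≤ p → p Fin.≤ pos (nth (S v) j) → ∃[ k ] pos (nth (S v) k) ≡ p
  intermediate ε i≤p p≤i = _ , Fin.≤-antisym i≤p p≤i
  intermediate {v} {i} {p = p} (ik ◅ walk) i≤p p≤j with pos (nth (S v) i) Fin.≟ p
  ... | yes eq = i , eq
  ... | no i≢p = intermediate walk (ℕ.≤-trans (pos-step ik) (Fin.≤∧≢⇒< i≤p i≢p)) p≤j

  convex : ∀ {v p} → pos (nth (S v) (proj₁ (low v))) Fin.≤ p → p Fin.≤ pos (nth (S v) (proj₁ (high v))) →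
           v ∈ B (bijection ⟨$⟩ˡ p)
  convex {v} {p} l≤p p≤r with k , refl ← intermediate (proj₂ (subtree v) (proj₁ (low v)) (proj₁ (high v))) l≤p p≤r =
    subst (λ t → v ∈ B t) (sym (inverseˡ bijection)) (∈-transpose⁻ B (nth-∈ (S v) k))

-- Blow-ups

module BlowUp {V : Set} {_~_ : Rel V 0ℓ}
  (_~?_ : Decidable _~_) (~-sym : Symmetric _~_) (~-irrefl : ∀ v → ¬ v ~ v)
  {n : ℕ} (enumeration : Fin n ↔ V) (m : ℕ) where

  open Inverse enumeration using (to; from; strictlyInverseˡ)

  π : Fin (m * n) → V
  π = to ∘ proj₂ ∘ Fin.remQuot {m} n

  copy : V → Fin m → Fin (m * n)
  copy v i = Fin.combine i (from v)

  π-copy : ∀ v i → π (copy v i) ≡ v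
  π-copy v i = trans (cong (to ∘ proj₂) (Fin.remQuot-combine i (from v))) (strictlyInverseˡ v)

  copy-injective : ∀ v → Injective _≡_ _≡_ (copy v)
  copy-injective v = Fin.combine-injectiveˡ _ (from v) _ (from v)

  blowUp : Graph
  blowUp = record
    { order  = m * n
    ; Adj    = λ x y → π x ~ π y
    ; Adj?   = λ x y → π x ~? π y
    ; sym    = ~-sym
    ; irrefl = ~-irrefl ∘ π
    }

  -- Pigeonhole: if all `m` copies were in `X`, indexing them would inject `Fin m` into `Fin ∣ X ∣`.
  surviving-copy : ∀ (X : Subset (m * n)) → ∣ X ∣ < m → ∀ v → ∃[ x ] (x ∉ X × π x ≡ v)
  surviving-copy X ∣X∣<m v with Fin.any? (λ i → ¬? (copy v i ∈? X))
  ... | yes (i , x∉X) = copy v i , x∉X , π-copy v i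
  ... | no none = contradiction (Fin.injective⇒≤ index-injective) (ℕ.<⇒≱ ∣X∣<m)
    where
    copy∈X : ∀ i → copy v i ∈ X
    copy∈X i = decidable-stable (copy v i ∈? X) λ x∉X → none (i , x∉X)
    index-injective : Injective _≡_ _≡_ (index ∘ copy∈X)
    index-injective {i} {j} eq = copy-injective v
      (trans (sym (nth-index (copy∈X i))) (trans (cong (nth X) eq) (nth-index (copy∈X j))))

  blowUp-kConnected : .{{NonZero n}} → ∀ {k} → k < m → V →
    (∀ u v → Star _~_ u v) → (∀ v → ∃[ w ] (v ~ w)) → KConnected k blowUp
  blowUp-kConnected k<m v₀ connected neighbour =
    ℕ.<-≤-trans k<m (ℕ.m≤m*n m n) , λ X ∣X∣<k → still-connected X (ℕ.<-trans ∣X∣<k k<m)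
    where
    still-connected : ∀ X → ∣ X ∣ < m → Connected (blowUp [ ∁ X ])
    still-connected X ∣X∣<m = proj₁ (rep v₀) , λ i j → lift (connected (p i) (p j)) refl refl
      where
      p : Fin ∣ ∁ X ∣ → V
      p = π ∘ nth (∁ X)
      rep : ∀ v → ∃[ i ] p i ≡ v
      rep v with x , x∉X , refl ← surviving-copy X ∣X∣<m v =
        index (x∉p⇒x∈∁p x∉X) , cong π (nth-index (x∉p⇒x∈∁p x∉X))
      -- The empty walk also has to join distinct copies of a vertex,
      -- which a common neighbour does.
      lift : ∀ {u v i j} → Star _~_ u v → p i ≡ u → p j ≡ v → Star (λ i j → p i ~ p j) i j
      lift {i = i} ε refl eq
        with w , v~w ← neighbour (p i)
        with k , refl ← rep w =
        v~w ◅ subst (p k ~_) (sym eq) (~-sym v~w) ◅ ε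
      lift (_◅_ {j = w} u~w walk) refl eq with k , refl ← rep w = u~w ◅ lift walk refl eq

  module _ (T : Graph) (isTree : IsTree T) (Bag : Vertex T → V → Set) (Bag? : ∀ t v → Dec (Bag t v)) where

    bags : Vertex T → Subset (m * n)
    bags t = ⟪ Bag? t ∘ π ⟫

    -- Pulls a decomposition of the original graph back along `π`. Connectedness of the node sets is
    -- asked for as descent to a root along falling node numbers, and the roots also cover the
    -- vertices.
    blowUpDecomposition :
      (∀ {u v} → u ~ v → ∃[ t ] (Bag t u × Bag t v)) →
      (∀ v → ∃[ root ] (Bag root v ×
        (∀ {t} → Bag t v → t ≢ root → ∃[ s ] (toℕ s < toℕ t × Adj T t s × Bag s v)))) →
      TreeDecomposition blowUp
    blowUpDecomposition edges subtrees = record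
      { tree           = T
      ; isTree         = isTree
      ; bag            = bags
      ; coversVertices = λ x → let root , v∈ , _ = subtrees (π x) in root , bags⁺ v∈
      ; coversEdges    = λ xy → let t , u∈ , v∈ = edges xy in t , bags⁺ u∈ , bags⁺ v∈
      ; subtree        = λ x → let root , v∈ , descend = subtrees (π x) in
          induced-connected-by-descent T _ (∈-transpose⁺ bags (bags⁺ v∈)) λ t∈ t≢root →
            let s , s<t , ts , v∈s = descend (bags⁻ (∈-transpose⁻ bags t∈)) t≢root
            in s , s<t , ts , ∈-transpose⁺ bags (bags⁺ v∈s)
      }
      where
      bags⁺ : ∀ {t x} → Bag t (π x) → x ∈ bags t
      bags⁺ {t} = ∈-⟪⟫⁺ (Bag? t ∘ π)
      bags⁻ : ∀ {t x} → x ∈ bags t → Bag t (π x)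
      bags⁻ {t} = ∈-⟪⟫⁻ (Bag? t ∘ π)

    bag-colourable : ∀ t {c} (colour : V → Fin c) →
      (∀ {u v} → Bag t u → Bag t v → u ~ v → colour u ≢ colour v) → Colourable (blowUp [ bags t ]) c
    bag-colourable t colour proper = colour ∘ π ∘ nth (bags t) , λ {i} {j} →
      proper (∈-⟪⟫⁻ (Bag? t ∘ π) (nth-∈ _ i)) (∈-⟪⟫⁻ (Bag? t ∘ π) (nth-∈ _ j))

-- The legs and hubs

infix 4 _∼_ _∼?_ _~_ _~?_

-- Adjacency within a single 5-cycle, as opposed to `_~_` on the whole graph.
_∼_ : Rel (Fin 5) 0ℓ
u ∼ v = next u ≡ v ⊎ next v ≡ u

_∼?_ : Decidable _∼_
u ∼? v = (next u Fin.≟ v) ⊎-dec (next v Fin.≟ u)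

∼-sym : Symmetric _∼_
∼-sym = swap

∼-irrefl : ∀ v → ¬ v ∼ v
∼-irrefl = from-yes (Fin.all? λ v → ¬? (v ∼? v))

next⁵ : ∀ v → next (next (next (next (next v)))) ≡ v
next⁵ = from-yes (Fin.all? λ v → next (next (next (next (next v)))) Fin.≟ v)

relative-position : ∀ u v → u ≡ v ⊎ u ∼ v ⊎ next (next u) ≡ v ⊎ next (next v) ≡ u
relative-position = from-yes (Fin.all? λ u → Fin.all? λ v →
  (u Fin.≟ v) ⊎-dec (u ∼? v) ⊎-dec (next (next u) Fin.≟ v) ⊎-dec (next (next v) Fin.≟ u))

-- Decodes a hub's number into its triple of positions, one per leg.
spoke : Fin (5 ^ 3) → Fin 3 → Fin 5
spoke = finToFun

V : Set
V = (Fin 3 × Fin 5) ⊎ Fin (5 ^ 3)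

pattern rim i u = inj₁ (i , u)
pattern hub z   = inj₂ z

_~_ : Rel V 0ℓ
rim i u ~ rim j v = i ≡ j × u ∼ v
rim i u ~ hub z   = u ∼ spoke z i
hub z   ~ rim i u = spoke z i ∼ u
hub _   ~ hub _   = ⊥

_~?_ : Decidable _~_
rim i u ~? rim j v = (i Fin.≟ j) ×-dec (u ∼? v)
rim i u ~? hub z   = u ∼? spoke z i
hub z   ~? rim i u = spoke z i ∼? u
hub _   ~? hub _   = no id

~-sym : Symmetric _~_
~-sym {rim i u} {rim j v} (i≡j , uv) = sym i≡j , ∼-sym uv
~-sym {rim i u} {hub z}   uz = ∼-sym uz
~-sym {hub z}   {rim i u} zu = ∼-sym zu

~-irrefl : ∀ v → ¬ v ~ v
~-irrefl (rim i u) (_ , uu) = ∼-irrefl u uu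

enumeration : Fin (3 * 5 + 5 ^ 3) ↔ V
enumeration = (Fin.*↔× ⊎-↔ ↔-id _) ↔-∘ Fin.+↔⊎

neighbour : ∀ v → ∃[ w ] (v ~ w)
neighbour (rim i u) = rim i (next u) , refl , inj₁ refl
neighbour (hub z)   = rim 0F (next (spoke z 0F)) , inj₁ refl

~-connected : ∀ v w → Star _~_ v w
~-connected v w = to-origin v ◅◅ reverse (λ {v} {w} → ~-sym {v} {w}) (to-origin w)
  where
  step : ∀ {u} → rim 0F u ~ rim 0F (next u)
  step = refl , inj₁ refl
  around : ∀ u → Star _~_ (rim 0F u) (rim 0F 0F)
  around 0F = ε
  around 1F = step ◅ step ◅ step ◅ step ◅ ε
  around 2F = step ◅ step ◅ step ◅ ε
  around 3F = step ◅ step ◅ ε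
  around 4F = step ◅ ε
  from-hub : ∀ z → Star _~_ (hub z) (rim 0F 0F)
  from-hub z = inj₁ refl ◅ around (next (spoke z 0F))
  to-origin : ∀ v → Star _~_ v (rim 0F 0F)
  -- The hub at position `next u` on every leg is adjacent to `u` on leg `i` and leads over to leg
  -- 0.
  to-origin (rim i u) =
    _◅_ {j = hub z} (inj₁ (sym (Fin.finToFun-funToFin (const (next u)) i))) (from-hub z)
    where z = funToFin {3} (const (next u))
  to-origin (hub z) = from-hub z

-- The lower bound for path-decompositions

module _ {N : ℕ} (l r : Fin 5 → Fin N) where

  Spans : Fin N → Fin 5 → Set
  Spans p v = l v Fin.≤ p × p Fin.≤ r v

  -- At `q`, hubs imitating `v₀` and `v₂` will form a pentagon with the other three vertices.
  record Critical : Set where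
    field
      {v₀ v₁ v₂ v₃ v₄} : Fin 5
      v₀∼v₁ : v₀ ∼ v₁
      v₁∼v₂ : v₁ ∼ v₂
      v₂∼v₃ : v₂ ∼ v₃
      v₃∼v₄ : v₃ ∼ v₄
      v₄∼v₀ : v₄ ∼ v₀
      q     : Fin N
      r₀≤q  : r v₀ Fin.≤ q
      q≤l₂  : q Fin.≤ l v₂
      spans₁ : Spans q v₁
      spans₃ : Spans q v₃
      spans₄ : Spans q v₄

glb : ∀ {N} (x y : Fin N) → ∃[ z ] (z Fin.≤ x × z Fin.≤ y × (∀ {w : Fin N} → w Fin.≤ x → w Fin.≤ y → w Fin.≤ z))
glb x y with Fin.≤-total x y
... | inj₁ x≤y = x , ℕ.≤-refl , x≤y , λ w≤x _ → w≤x
... | inj₂ y≤x = y , y≤x , ℕ.≤-refl , λ _ w≤y → w≤y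

module _ {N : ℕ} {l r : Fin 5 → Fin N}
  (l≤r : ∀ v → l v Fin.≤ r v) (meet : ∀ {u v} → u ∼ v → l u Fin.≤ r v) where

  -- Take `q` as the minimum of `r v₄` and `l v₂`. Then `v₁` spans everything from `r v₀` to `l v₂`;
  -- `v₄` starts by `r v₀` and ends no earlier than `q`; `v₃` starts by both terms of the minimum
  -- and ends no earlier than `l v₂`.
  extremes⇒critical : ∀ {v₀ v₁ v₂ v₃ v₄} → v₀ ∼ v₁ → v₁ ∼ v₂ → v₂ ∼ v₃ → v₃ ∼ v₄ → v₄ ∼ v₀ →
    (∀ v → r v₀ Fin.≤ r v) → (∀ v → l v Fin.≤ l v₂) → r v₀ Fin.≤ l v₂ → Critical l r
  extremes⇒critical {v₀} {v₁} {v₂} {v₃} {v₄} v₀∼v₁ v₁∼v₂ v₂∼v₃ v₃∼v₄ v₄∼v₀ first last r₀≤l₂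
    with q , q≤r₄ , q≤l₂ , greatest ← glb (r v₄) (l v₂) = record
    { v₀∼v₁ = v₀∼v₁ ; v₁∼v₂ = v₁∼v₂ ; v₂∼v₃ = v₂∼v₃ ; v₃∼v₄ = v₃∼v₄ ; v₄∼v₀ = v₄∼v₀
    ; q      = q
    ; r₀≤q   = r₀≤q
    ; q≤l₂   = q≤l₂
    ; spans₁ = ℕ.≤-trans (meet (∼-sym v₀∼v₁)) r₀≤q , ℕ.≤-trans q≤l₂ (meet (∼-sym v₁∼v₂))
    ; spans₃ = greatest (meet v₃∼v₄) (last v₃) , ℕ.≤-trans q≤l₂ (meet v₂∼v₃)
    ; spans₄ = ℕ.≤-trans (meet v₄∼v₀) r₀≤q , q≤r₄
    }
    where
    r₀≤q = greatest (first v₄) r₀≤l₂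

  -- If the last start is at most the first end, that end is common to all intervals. This also
  -- holds when the two extreme vertices are equal or adjacent, which leaves distance two on the
  -- cycle.
  common⊎critical : (∃[ p ] ∀ v → Spans l r p v) ⊎ Critical l r
  common⊎critical
    with v₀ , first ← ∃-min 0F (toℕ ∘ r)
    with w , last ← ∃-max 0F (toℕ ∘ l)
    with Fin.≤-total (l w) (r v₀)
  ... | inj₁ l≤r₀ = inj₁ (r v₀ , λ v → ℕ.≤-trans (last v) l≤r₀ , first v)
  ... | inj₂ r₀≤l with relative-position v₀ w
  ...   | inj₁ refl = inj₁ (r v₀ , λ v → ℕ.≤-trans (last v) (l≤r v₀) , first v)
  ...   | inj₂ (inj₁ v₀∼w) = inj₁ (r v₀ , λ v → ℕ.≤-trans (last v) (meet (∼-sym v₀∼w)) , first v)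
  ...   | inj₂ (inj₂ (inj₁ refl)) = inj₂ (extremes⇒critical
    (inj₁ refl) (inj₁ refl) (inj₁ refl) (inj₁ refl) (inj₁ (next⁵ v₀)) first last r₀≤l)
  -- Here `w` lies two steps behind `v₀`, so the cycle is traversed backwards.
  ...   | inj₂ (inj₂ (inj₂ refl)) = inj₂ (extremes⇒critical
    (inj₂ refl) (inj₂ refl) (inj₂ (next⁵ w)) (inj₂ refl) (inj₂ refl) first last r₀≤l)

sorted : ∀ {N} (q : Fin 3 → Fin N) → ∃[ i ] ∃[ j ] ∃[ k ]
  (i ≢ j × k ≢ j × i ≢ k × q i Fin.≤ q j × q j Fin.≤ q k)
sorted q with Fin.≤-total (q 0F) (q 1F) | Fin.≤-total (q 1F) (q 2F) | Fin.≤-total (q 0F) (q 2F)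
... | inj₁ q₀≤q₁ | inj₁ q₁≤q₂ | _          = 0F , 1F , 2F , (λ ()) , (λ ()) , (λ ()) , q₀≤q₁ , q₁≤q₂
... | inj₁ q₀≤q₁ | inj₂ q₂≤q₁ | inj₁ q₀≤q₂ = 0F , 2F , 1F , (λ ()) , (λ ()) , (λ ()) , q₀≤q₂ , q₂≤q₁
... | inj₁ q₀≤q₁ | inj₂ q₂≤q₁ | inj₂ q₂≤q₀ = 2F , 0F , 1F , (λ ()) , (λ ()) , (λ ()) , q₂≤q₀ , q₀≤q₁
... | inj₂ q₁≤q₀ | inj₁ q₁≤q₂ | inj₁ q₀≤q₂ = 1F , 0F , 2F , (λ ()) , (λ ()) , (λ ()) , q₁≤q₀ , q₀≤q₂
... | inj₂ q₁≤q₀ | inj₁ q₁≤q₂ | inj₂ q₂≤q₀ = 1F , 2F , 0F , (λ ()) , (λ ()) , (λ ()) , q₁≤q₂ , q₂≤q₀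
... | inj₂ q₁≤q₀ | inj₂ q₂≤q₁ | _          = 2F , 1F , 0F , (λ ()) , (λ ()) , (λ ()) , q₂≤q₁ , q₁≤q₀

hub-through : ∀ {i j k : Fin 3} → i ≢ j → k ≢ j → i ≢ k → ∀ a b c →
  ∃[ z ] (spoke z i ≡ a × spoke z j ≡ b × spoke z k ≡ c)
hub-through {i} {j} {k} i≢j k≢j i≢k a b c = funToFin f ,
  trans (Fin.finToFun-funToFin f i) (updateAt-updates i g) ,
  trans (Fin.finToFun-funToFin f j)
    (trans (updateAt-minimal j i g (≢-sym i≢j)) (updateAt-minimal j k (const b) (≢-sym k≢j))) ,
  trans (Fin.finToFun-funToFin f k) (trans (updateAt-minimal k i g (≢-sym i≢k)) (updateAt-updates k (const b)))
  where
  g f : Fin 3 → Fin 5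
  g = updateAt (const b) k (const c)
  f = updateAt g i (const a)

module _ {N : ℕ} (l r : V → Fin N)
  (l≤r : ∀ v → l v Fin.≤ r v) (meet : ∀ {u v} → u ~ v → l u Fin.≤ r v) where

  private
    legₗ legᵣ : Fin 3 → Fin 5 → Fin N
    legₗ i = l ∘ rim i
    legᵣ i = r ∘ rim i

  PentagonAt : Fin N → Set
  PentagonAt p = Pentagon _~_ (λ v → l v Fin.≤ p × p Fin.≤ r v)

  pentagon-in-leg : ∀ i {p} → (∀ v → Spans (legₗ i) (legᵣ i) p v) → PentagonAt p
  pentagon-in-leg i spans = record { corner = rim i ; side = λ _ → refl , inj₁ refl ; inside = spans }

  pentagon-through-hubs : (∀ i → Critical (legₗ i) (legᵣ i)) → ∃ PentagonAt
  pentagon-through-hubs critical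
    with i , j , k , i≢j , k≢j , i≢k , qᵢ≤qⱼ , qⱼ≤qₖ ← sorted (Critical.q ∘ critical) =
    Critical.q (critical j) , pentagon
    where
    module I = Critical (critical i)
    module J = Critical (critical j)
    module K = Critical (critical k)

    -- Position `v₁` on the outer legs makes the hub adjacent to `v₀` on leg `i`, which has ended by
    -- `J.q`, and to `v₂` on leg `k`, which starts no earlier; `m` remains free.
    through : ∀ m → ∃[ z ] (spoke z j ≡ m × l (hub z) Fin.≤ J.q × J.q Fin.≤ r (hub z))
    through m with z , zᵢ , zⱼ , zₖ ← hub-through i≢j k≢j i≢k I.v₁ m K.v₁ = z , zⱼ ,
      ℕ.≤-trans (meet {hub z} {rim i I.v₀} (subst (_∼ I.v₀) (sym zᵢ) (∼-sym I.v₀∼v₁))) (ℕ.≤-trans I.r₀≤q qᵢ≤qⱼ) ,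
      ℕ.≤-trans qⱼ≤qₖ (ℕ.≤-trans K.q≤l₂ (meet {rim k K.v₂} {hub z} (subst (K.v₂ ∼_) (sym zₖ) (∼-sym K.v₁∼v₂))))

    -- The hub `z` replaces `v₂` and `z′` replaces `v₀`; these are not consecutive on the leg, so no
    -- edge between hubs is called for.
    pentagon : PentagonAt J.q
    pentagon with z , zⱼ , z-spans ← through J.v₂ | z′ , z′ⱼ , z′-spans ← through J.v₀ = record
      { corner = corner
      ; side   = side
      ; inside = λ { 0F → J.spans₁ ; 1F → z-spans ; 2F → J.spans₃ ; 3F → J.spans₄ ; 4F → z′-spans }
      }
      where
      corner : Fin 5 → V
      corner 0F = rim j J.v₁
      corner 1F = hub z
      corner 2F = rim j J.v₃
      corner 3F = rim j J.v₄
      corner 4F = hub z′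
      side : ∀ x → corner x ~ corner (next x)
      side 0F = subst (J.v₁ ∼_) (sym zⱼ) J.v₁∼v₂
      side 1F = subst (_∼ J.v₃) (sym zⱼ) J.v₂∼v₃
      side 2F = refl , J.v₃∼v₄
      side 3F = subst (J.v₄ ∼_) (sym z′ⱼ) J.v₄∼v₀
      side 4F = subst (_∼ J.v₁) (sym z′ⱼ) J.v₀∼v₁

  pentagon-position : ∃ PentagonAt
  pentagon-position with leg 0F | leg 1F | leg 2F
    where
    leg : ∀ i → (∃[ p ] ∀ v → Spans (legₗ i) (legᵣ i) p v) ⊎ Critical (legₗ i) (legᵣ i)
    leg i = common⊎critical (l≤r ∘ rim i) λ uv → meet (refl , uv)
  ... | inj₁ (p , spans) | _ | _ = p , pentagon-in-leg 0F spans
  ... | _ | inj₁ (p , spans) | _ = p , pentagon-in-leg 1F spans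
  ... | _ | _ | inj₁ (p , spans) = p , pentagon-in-leg 2F spans
  ... | inj₂ c₀ | inj₂ c₁ | inj₂ c₂ = pentagon-through-hubs λ { 0F → c₀ ; 1F → c₁ ; 2F → c₂ }

-- The lower bound for trees, and explicit decompositions for both upper bounds

bag-not-1-colourable : ∀ {G} (D : TreeDecomposition G) u v → Adj G u v → ∃[ t ] ¬ Colourable (G [ bag D t ]) 1
bag-not-1-colourable {G} D u v uv with t , u∈ , v∈ ← TreeDecomposition.coversEdges D uv =
  t , edge⇒¬1-colourable {G [ bag D t ]}
        (subst₂ (Adj G) (sym (nth-index u∈)) (sym (nth-index v∈)) uv)

module _ {c : ℕ} (κ : Fin 5 → Fin c) where

  ProperBetween : Subset 5 → Subset 5 → Set
  ProperBetween U M = ∀ u v → u ∈ U → v ∈ M → u ∼ v → κ u ≢ κ v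

  properBetween? : ∀ U M → Dec (ProperBetween U M)
  properBetween? U M = Fin.all? λ u → Fin.all? λ v →
    (u ∈? U) →-dec (v ∈? M) →-dec (u ∼? v) →-dec ¬? (κ u Fin.≟ κ v)

module _ (i : Fin 3) (U M : Subset 5) where

  LegBag : V → Set
  LegBag (rim j u) = i ≡ j × u ∈ U
  LegBag (hub z)   = spoke z i ∈ M

  legBag? : ∀ v → Dec (LegBag v)
  legBag? (rim j u) = (i Fin.≟ j) ×-dec (u ∈? U)
  legBag? (hub z)   = spoke z i ∈? M

legColour : ∀ {c} → Fin 3 → (Fin 5 → Fin c) → V → Fin c
legColour i κ (rim _ u) = κ u
legColour i κ (hub z)   = κ (spoke z i)

-- Replacing each hub by its position on leg `i` sends every edge of the bag to a cycle edge between
-- `U` and `M`; edges within the rim are included because `U ⊆ M`.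
legColour-proper : ∀ {c i U M} {κ : Fin 5 → Fin c} → U ⊆ M → ProperBetween κ U M →
  ∀ {u v} → LegBag i U M u → LegBag i U M v → u ~ v → legColour i κ u ≢ legColour i κ v
legColour-proper U⊆M proper {rim _ u} {rim _ v} (_ , u∈)    (_ , v∈)    (_ , uv) = proper u v u∈ (U⊆M v∈) uv
legColour-proper U⊆M proper {rim _ u} {hub z}   (refl , u∈) z∈          uz = proper u _ u∈ z∈ uz
legColour-proper U⊆M proper {hub z}   {rim _ u} z∈          (refl , u∈) zu = proper u _ u∈ z∈ (∼-sym zu) ∘ sym

centre : Subset 5
centre = ⁅ 0F ⁆ ∪ ⁅ 2F ⁆

-- A hub at position 1 would close a 5-cycle with the path 2, 3, 4, 0, so the second leaf omits it;
-- its edges to 0 and 2 are covered by the centre.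
rims spokes : Fin 2 → Subset 5
rims 0F = ⁅ 0F ⁆ ∪ ⁅ 1F ⁆ ∪ ⁅ 2F ⁆
rims 1F = ∁ ⁅ 1F ⁆
spokes 0F = full
spokes 1F = rims 1F

-- Node zero is the centre; the six leaves are numbered by pairs of a leg and a leaf type.
starBag : Fin 7 → V → Set
starBag zero (rim _ u) = u ∈ centre
starBag zero (hub _)   = ⊤
starBag (suc t) v      = let i , b = remQuot {3} 2 t in LegBag i (rims b) (spokes b) v

starBag? : ∀ t v → Dec (starBag t v)
starBag? zero (rim _ u) = u ∈? centre
starBag? zero (hub _)   = yes tt
starBag? (suc t) v      = legBag? _ _ _ v

leaf : Fin 3 → Fin 2 → Fin 7
leaf i b = suc (combine i b)

starBag-leaf : ∀ i b {v} → LegBag i (rims b) (spokes b) v → starBag (leaf i b) v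
starBag-leaf i b {v} = subst (λ (i , b) → LegBag i (rims b) (spokes b) v) (sym (Fin.remQuot-combine i b))

starBag-rim-rim : ∀ i u v → u ∼ v → ∃[ t ] (starBag t (rim i u) × starBag t (rim i v))
starBag-rim-rim i u v uv = let b , u∈ , v∈ = covered u v uv in
  leaf i b , starBag-leaf i b (refl , u∈) , starBag-leaf i b (refl , v∈)
  where
  covered : ∀ u v → u ∼ v → ∃[ b ] (u ∈ rims b × v ∈ rims b)
  covered = from-yes (Fin.all? λ u → Fin.all? λ v → (u ∼? v) →-dec
    Fin.any? λ b → (u ∈? rims b) ×-dec (v ∈? rims b))

-- Outside the centre, position 1 is in the first leaf with all hubs, while 3 and 4 have no cycle
-- neighbour at 1, so the second leaf contains the hub.
starBag-rim-hub : ∀ i u z → u ∼ spoke z i → ∃[ t ] (starBag t (rim i u) × starBag t (hub z))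
starBag-rim-hub i u z uz with covered u (spoke z i) uz
  where
  covered : ∀ u v → u ∼ v → u ∈ centre ⊎ ∃[ b ] (u ∈ rims b × v ∈ spokes b)
  covered = from-yes (Fin.all? λ u → Fin.all? λ v → (u ∼? v) →-dec
    ((u ∈? centre) ⊎-dec Fin.any? λ b → (u ∈? rims b) ×-dec (v ∈? spokes b)))
... | inj₁ u∈            = zero , u∈ , tt
... | inj₂ (b , u∈ , z∈) = leaf i b , starBag-leaf i b (refl , u∈) , starBag-leaf i b z∈

starBag-edges : ∀ {u v} → u ~ v → ∃[ t ] (starBag t u × starBag t v)
starBag-edges {rim i u} {rim .i v} (refl , uv) = starBag-rim-rim i u v uv
starBag-edges {rim i u} {hub z}    uz = starBag-rim-hub i u z uz
starBag-edges {hub z}   {rim i u}  zu =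
  let t , u∈ , z∈ = starBag-rim-hub i u z (∼-sym zu) in t , z∈ , u∈

-- Hubs and positions 0 and 2 are rooted at the centre, adjacent to every leaf; positions 1, 3 and 4
-- lie in one leaf only.
starBag-subtrees : ∀ v → ∃[ root ] (starBag root v ×
  (∀ {t} → starBag t v → t ≢ root → ∃[ s ] (toℕ s < toℕ t × Adj (star 6) t s × starBag s v)))
starBag-subtrees (hub z) = zero , tt , λ
  { {zero}  _ 0≢0 → contradiction refl 0≢0
  ; {suc _} _ _   → zero , s≤s z≤n , tt , tt }
starBag-subtrees (rim i u) with centre⊎unique u
  where
  centre⊎unique : ∀ u → u ∈ centre ⊎ ∃[ b ] (u ∈ rims b × (∀ b′ → u ∈ rims b′ → b′ ≡ b × ¬ u ∈ centre))
  centre⊎unique = from-yes (Fin.all? λ u → (u ∈? centre) ⊎-dec Fin.any? λ b → (u ∈? rims b) ×-dec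
    Fin.all? λ b′ → (u ∈? rims b′) →-dec ((b′ Fin.≟ b) ×-dec ¬? (u ∈? centre)))
... | inj₁ u∈ = zero , u∈ , λ
  { {zero}  _ 0≢0 → contradiction refl 0≢0
  ; {suc _} _ _   → zero , s≤s z≤n , tt , u∈ }
... | inj₂ (b , u∈ , unique) = leaf i b , starBag-leaf i b (refl , u∈) , λ
  { {zero}  u∈centre _ → contradiction u∈centre (proj₂ (unique b u∈))
  ; {suc t} (refl , u∈′) t≢leaf → contradiction
      (cong suc (trans (sym (Fin.combine-remQuot {3} 2 t)) (cong (combine i) (proj₁ (unique _ u∈′))))) t≢leaf }

-- In the first row only the cycle edge 3, 4 is monochromatic, and it avoids `rims 0F`. In the
-- second row the path 2, 3, 4, 0 alternates and the value at 1 is a filler.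
twoColour : Fin 2 → Fin 5 → Fin 2
twoColour 0F = lookup (1F ∷ 0F ∷ 1F ∷ 0F ∷ 0F ∷ [])
twoColour 1F = lookup (1F ∷ 0F ∷ 0F ∷ 1F ∷ 0F ∷ [])

twoColour-proper : ∀ b → ProperBetween (twoColour b) (rims b) (spokes b)
twoColour-proper 0F = from-yes (properBetween? (twoColour 0F) (rims 0F) (spokes 0F))
twoColour-proper 1F = from-yes (properBetween? (twoColour 1F) (rims 1F) (spokes 1F))

rims⊆spokes : ∀ b → rims b ⊆ spokes b
rims⊆spokes 0F = ⊆⊤
rims⊆spokes 1F = ⊆-refl

starColour : Fin 7 → V → Fin 2
starColour zero (rim _ _) = 0F
starColour zero (hub _)   = 1F
starColour (suc t)        = let i , b = remQuot {3} 2 t in legColour i (twoColour b)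

starColour-proper : ∀ t {u v} → starBag t u → starBag t v → u ~ v → starColour t u ≢ starColour t v
starColour-proper zero {rim _ u} {rim _ v} u∈ v∈ (_ , uv) = contradiction uv (centre-independent u v u∈ v∈)
  where
  centre-independent : ∀ u v → u ∈ centre → v ∈ centre → ¬ u ∼ v
  centre-independent = from-yes (Fin.all? λ u → Fin.all? λ v → (u ∈? centre) →-dec (v ∈? centre) →-dec ¬? (u ∼? v))
starColour-proper zero {rim _ _} {hub _}   _ _ _ ()
starColour-proper zero {hub _}   {rim _ _} _ _ _ ()
starColour-proper (suc t) {u} {v} = let i , b = remQuot {3} 2 t in
  legColour-proper {i = i} (rims⊆spokes b) (twoColour-proper b) {u} {v}

pathBag : Fin 3 → V → Set
pathBag i = LegBag i full full

pathBag? : ∀ i v → Dec (pathBag i v)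
pathBag? i = legBag? i full full

pathBag-edges : ∀ {u v} → u ~ v → ∃[ i ] (pathBag i u × pathBag i v)
pathBag-edges {rim i u} {rim .i v} (refl , _) = i , (refl , ∈⊤) , (refl , ∈⊤)
pathBag-edges {rim i u} {hub z}   _ = i , (refl , ∈⊤) , ∈⊤
pathBag-edges {hub z}   {rim i u} _ = i , ∈⊤ , (refl , ∈⊤)

pathBag-subtrees : ∀ v → ∃[ root ] (pathBag root v ×
  (∀ {t} → pathBag t v → t ≢ root → ∃[ s ] (toℕ s < toℕ t × Adj (pathGraph 3) t s × pathBag s v)))
pathBag-subtrees (rim i u) = i , (refl , ∈⊤) , λ { (i≡i , _) i≢i → contradiction i≡i i≢i }
pathBag-subtrees (hub z)   = zero , ∈⊤ , λ
  { {zero}  _ 0≢0 → contradiction refl 0≢0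
  ; {suc i} _ _   → inject₁ i , s≤s (ℕ.≤-reflexive (Fin.toℕ-inject₁ i)) , inj₂ (cong suc (Fin.toℕ-inject₁ i)) , ∈⊤ }

threeColour : Fin 5 → Fin 3
threeColour = lookup (0F ∷ 1F ∷ 0F ∷ 1F ∷ 2F ∷ [])

threeColour-proper : ProperBetween threeColour full full
threeColour-proper = from-yes (properBetween? threeColour full full)

-- The blown-up graphs and their two chromatic numbers

module _ (m : ℕ) where

  open BlowUp _~?_ (λ {u} {v} → ~-sym {u} {v}) ~-irrefl enumeration (suc m) public

  copy-adjacent : ∀ {u v} → u ~ v → Adj blowUp (copy u zero) (copy v zero)
  copy-adjacent {u} {v} = subst₂ _~_ (sym (π-copy u zero)) (sym (π-copy v zero))

  blowUp-treeChromaticNumber : TreeChromaticNumber blowUp 2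
  blowUp-treeChromaticNumber =
    (D , exact-chromatic-number D
      (λ t → bag-colourable (star 6) (star-isTree 6) starBag starBag? t (starColour t) (starColour-proper t))
      (some-bag D)) ,
    λ { _ (D′ , χ) → uncolourable⇒< D′ (some-bag D′) χ }
    where
    D : TreeDecomposition blowUp
    D = blowUpDecomposition (star 6) (star-isTree 6) starBag starBag? starBag-edges starBag-subtrees
    some-bag : (D : TreeDecomposition blowUp) → ∃[ t ] ¬ Colourable (blowUp [ bag D t ]) 1
    some-bag D = bag-not-1-colourable D (copy (rim 0F 0F) zero) (copy (rim 0F 1F) zero)
      (copy-adjacent {rim 0F 0F} {rim 0F 1F} (refl , inj₁ refl))

  -- The zeroth copies form the original graph inside the blow-up, so their intervals yield a
  -- pentagon in one bag.
  bag-not-2-colourable : (D : PathDecomposition blowUp) →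
    ∃[ t ] ¬ Colourable (blowUp [ bag (treeDecomposition D) t ]) 2
  bag-not-2-colourable D = node p , pentagon⇒¬2-colourable {blowUp} record
    { corner = first ∘ corner
    ; side   = λ i → copy-adjacent {corner i} {corner (next i)} (side i)
    ; inside = λ i → let l≤p , p≤r = inside i in convex l≤p p≤r
    }
    where
    open IntervalModel (intervalModel D)
    first : V → Vertex blowUp
    first v = copy v zero
    position = pentagon-position (l ∘ first) (r ∘ first) (l≤r ∘ first)
      λ {u} {v} uv → meet {first u} {first v} (copy-adjacent {u} {v} uv)
    p = proj₁ position
    open Pentagon (proj₂ position)

  blowUp-pathChromaticNumber : PathChromaticNumber blowUp 3
  blowUp-pathChromaticNumber =
    (D , exact-chromatic-number (treeDecomposition D)
      (λ i → bag-colourable (pathGraph 3) (pathGraph-isTree 2) pathBag pathBag? i (legColour i threeColour)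
        λ {u} {v} → legColour-proper {i = i} ⊆⊤ threeColour-proper {u} {v})
      (bag-not-2-colourable D)) ,
    λ { _ (D′ , χ) → uncolourable⇒< (treeDecomposition D′) (bag-not-2-colourable D′) χ }
    where
    D : PathDecomposition blowUp
    D = record
      { treeDecomposition = blowUpDecomposition (pathGraph 3) (pathGraph-isTree 2)
          pathBag pathBag? pathBag-edges pathBag-subtrees
      ; isPath = 3 , record { bijection = ↔-id _ ; preserves = λ _ _ → ⇔-id _ }
      }

corollary1p4 : (k : ℕ) → k ≥ 1 →
    Σ (ℕ → Graph) λ F →
    (∀ i j → i ≢ j → ¬ (F i ≅ F j)) ×
    (∀ i → KConnected k (F i) ×
    (∃₂ λ χT χP → TreeChromaticNumber (F i) χT × PathChromaticNumber (F i) χP × (χT ≢ χP)))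
corollary1p4 k _ = (λ i → blowUp (k + i)) ,
  -- Different members have different orders: member `i` has `suc (k + i)` copies of each of 140
  -- vertices.
  (λ i j i≢j iso → i≢j (ℕ.+-cancelˡ-≡ k i j (ℕ.suc-injective
    (ℕ.*-cancelʳ-≡ (suc (k + i)) (suc (k + j)) (3 * 5 + 5 ^ 3) (↔⇒≡ (_≅_.bijection iso)))))) ,
  λ i → blowUp-kConnected (k + i) (s≤s (ℕ.m≤m+n k i)) (rim 0F 0F) ~-connected neighbour ,
        2 , 3 , blowUp-treeChromaticNumber (k + i) , blowUp-pathChromaticNumber (k + i) , λ ()
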